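{- For every integer $n \ge 6$, $\gamma^{\rm ID}(K_n \times K_{2n-5}) = 2n-4$.
   Context: For a graph $G$ and vertex $x$, $N[x]$ denotes the closed neighborhood of $x$. A set $C \subseteq V(G)$ is an identifying code (ID code) of $G$ if $C$ is a dominating set of $G$ and $N[x]\cap C \ne N[y]\cap C$ for every pair of distinct vertices $x,y$. $\gamma^{\rm ID}(G)$ is the minimum cardinality of an ID code of $G$. The direct product $G_1\times G_2$ has vertex set $V(G_1)\times V(G_2)$, with $(u_1,u_2)$ adjacent to $(v_1,v_2)$ iff $u_1v_1\in E(G_1)$ and $u_2v_2 \in E(G_2)$. $K_n$ is the complete graph on vertex set $[n]=\{1,\dots,n\}$; thus in $K_n\times K_m$ two vertices are adjacent iff they differ in both coordinates. -}

module Defs where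

open import Data.Fin.Base using (Fin)
open import Data.List.Base using (List; length)
open import Data.List.Membership.Propositional using () renaming (_∈_ to _∈ₗ_)
open import Data.List.Relation.Unary.Unique.Propositional using (Unique)
open import Data.Nat.Base using (ℕ; _≤_)
open import Data.Product.Base using (∃; _×_; _,_; proj₁)
open import Data.Sum.Base using (_⊎_)
open import Level using (0ℓ)
open import Relation.Binary.Core using (Rel)
open import Relation.Binary.Definitions using (Symmetric; Irreflexive)
open import Relation.Binary.PropositionalEquality using (_≡_; _≢_; cong; ≢-sym)
open import Relation.Nullary.Negation using (¬_)
open import Relation.Unary using (Pred; _∩_; _≐_; Satisfiable)

record Graph : Set₁ where
  field
    V      : Set
    Adj    : Rel V 0ℓ
    sym    : Symmetric Adj
    irrefl : Irreflexive _≡_ Adj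

open Graph public using (V)

K : ℕ → Graph
K n = record
  { V      = Fin n
  ; Adj    = _≢_
  ; sym    = ≢-sym
  ; irrefl = λ x≡y x≢y → x≢y x≡y
  }

infixr 7 _⊗_

-- The direct (tensor, categorical) product, written G₁ × G₂ in graph theory.
_⊗_ : Graph → Graph → Graph
G ⊗ H = record
  { V      = G.V × H.V
  ; Adj    = λ (u₁ , u₂) (v₁ , v₂) → G.Adj u₁ v₁ × H.Adj u₂ v₂
  ; sym    = λ (a , b) → G.sym a , H.sym b
  ; irrefl = λ eq (a , _) → G.irrefl (cong proj₁ eq) a
  }
  where
  module G = Graph G
  module H = Graph H

module _ (G : Graph) where
  open Graph G using (Adj)

  N[_] : V G → Pred (V G) 0ℓ
  N[ x ] v = v ≡ x ⊎ Adj x v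

  IsDominating : Pred (V G) 0ℓ → Set
  IsDominating C = ∀ x → Satisfiable (N[ x ] ∩ C)

  IsSeparating : Pred (V G) 0ℓ → Set
  IsSeparating C = ∀ x y → x ≢ y → ¬ (N[ x ] ∩ C ≐ N[ y ] ∩ C)

  IsIDCode : Pred (V G) 0ℓ → Set
  IsIDCode C = IsDominating C × IsSeparating C

  -- A finite vertex set is given by a duplicate-free list of its elements,
  -- so that its cardinality is the length of the list.
  HasIDCodeOfSize : ℕ → Set
  HasIDCodeOfSize k =
    ∃ λ (C : List (V G)) → Unique C × length C ≡ k × IsIDCode (_∈ₗ C)

-- A relation and not a function, because a graph having two vertices with equal
-- closed neighbourhoods has no identifying code.
γᴵᴰ[_]≡_ : Graph → ℕ → Set
γᴵᴰ[ G ]≡ k = HasIDCodeOfSize G k × (∀ j → HasIDCodeOfSize G j → k ≤ j)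

{-# OPTIONS --safe #-}

-- View a code C in K n ⊗ K m as the edge set of a bipartite graph between n
-- rows and m columns.  Two vertices in a common row have the same trace on C
-- iff both of their columns are empty (dually for columns), and two vertices in
-- different rows and columns have the same trace iff all codewords on the four
-- lines through them lie in the 2 × 2 grid that these lines span ("confined").
--
-- Lower bound: if |C| ≤ m = 2n − 5, then, at most one row being empty, at least
-- three rows carry a single codeword.  The degrees d of the columns satisfy
-- Σ (d − 1) ≤ 0, and at most one column is empty, so Σ (d ∸ 1) ≤ 1: at most one
-- column is heavy (d ≥ 2), in which case d = 2 and there is an empty column.
-- Two single codewords in a common column would be confined by that column and
-- the empty one, and two in distinct columns are confined unless one of these
-- is heavy.  So three single codewords yield two heavy columns.
--
-- Upper bound: a star with three rows and one column, one isolated edge, n − 4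
-- stars with one row and two columns, and one empty column.

module Submission where

open import Defs
open import Data.Empty using (⊥; ⊥-elim)
open import Data.Fin.Base using (Fin; zero; suc; _↑ʳ_; quotient; combine)
open import Data.Fin.Properties using (_≟_; ↑ʳ-injective; remQuot-combine; combine-injectiveʳ)
open import Data.List.Base using (List; []; _∷_; length; map; filter; allFin)
open import Data.List.Membership.Propositional using () renaming (_∈_ to _∈ₗ_)
open import Data.List.Membership.Propositional.Properties
  using (∈-filter⁺; ∈-filter⁻; ∈-allFin; ∈-map⁺; ∈-map⁻)
open import Data.List.Properties using (filter-reject; map-cong-local; length-map; length-tabulate)
open import Data.List.Relation.Unary.All using (All; []; _∷_) renaming (map to All-map)
import Data.List.Relation.Unary.All.Properties as All
open import Data.List.Relation.Unary.AllPairs using ([]; _∷_)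
open import Data.List.Relation.Unary.Any using (here; there)
open import Data.List.Relation.Unary.Unique.Propositional using (Unique)
import Data.List.Relation.Unary.Unique.Propositional.Properties as Unique
open import Data.Nat using (ℕ; zero; suc; _+_; _*_; _∸_; _≤_; z≤n; s≤s; s≤s⁻¹)
open import Data.Nat.ListAction using (sum)
open import Data.Nat.Properties
  using (≤-reflexive; ≤-trans; module ≤-Reasoning; _≤?_; ≮⇒≥; ≰⇒>; 1+n≰n; m≤m+n; m≤n+m; m≤n⇒∃[o]m+o≡n;
         +-comm; +-suc; +-monoʳ-≤; +-monoˡ-≤; +-mono-≤; +-cancelˡ-≤; *-monoʳ-≤; ∸-monoˡ-≤)
  renaming (_≟_ to _≟ℕ_)
open import Data.Nat.Tactic.RingSolver using (solve-∀)
open import Data.Product.Base using (∃; _×_; _,_; proj₁; proj₂)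
open import Data.Sum.Base using (_⊎_; inj₁; inj₂; swap; [_,_]′)
open import Function.Base using (_∘_)
open import Relation.Binary.PropositionalEquality
  using (_≡_; _≢_; refl; sym; trans; cong; subst; ≢-sym)
open import Relation.Nullary.Decidable using (yes; no)
open import Relation.Nullary.Negation using (¬_; contradiction)
open import Relation.Unary using (Pred; Decidable; _∩_; _⊆_; _≐_)
open import Level using (0ℓ)

-- Counting in lists: short lists, filters and sums.

module _ {A : Set} where

  length≤1⇒≡ : ∀ {xs : List A} {x y} → length xs ≤ 1 → x ∈ₗ xs → y ∈ₗ xs → x ≡ y
  length≤1⇒≡ {_ ∷ []}    _        (here refl) (here refl) = refl
  length≤1⇒≡ {_ ∷ _ ∷ _} (s≤s ())

  length≤2⇒≡⊎≡ : ∀ {xs : List A} {x y z} → length xs ≤ 2 → x ≢ y →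
                 x ∈ₗ xs → y ∈ₗ xs → z ∈ₗ xs → z ≡ x ⊎ z ≡ y
  length≤2⇒≡⊎≡ l x≢y (here refl) (here refl) z∈         = contradiction refl x≢y
  length≤2⇒≡⊎≡ l x≢y (here refl) (there y∈) (here refl) = inj₁ refl
  length≤2⇒≡⊎≡ l x≢y (here refl) (there y∈) (there z∈)  = inj₂ (length≤1⇒≡ (s≤s⁻¹ l) z∈ y∈)
  length≤2⇒≡⊎≡ l x≢y (there x∈) (here refl) (here refl) = inj₂ refl
  length≤2⇒≡⊎≡ l x≢y (there x∈) (here refl) (there z∈)  = inj₁ (length≤1⇒≡ (s≤s⁻¹ l) z∈ x∈)
  length≤2⇒≡⊎≡ l x≢y (there x∈) (there y∈) z∈           = contradiction (length≤1⇒≡ (s≤s⁻¹ l) x∈ y∈) x≢y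

  module _ {P : Pred A 0ℓ} (P? : Decidable P) where

    length-filter≤1 : (∀ {x y} → P x → P y → x ≡ y) →
                      ∀ {xs} → Unique xs → length (filter P? xs) ≤ 1
    length-filter≤1 P-unique {xs} xs! with filter P? xs | All.all-filter P? xs | Unique.filter⁺ P? xs!
    ... | []        | _             | _              = z≤n
    ... | _ ∷ []    | _             | _              = s≤s z≤n
    ... | _ ∷ _ ∷ _ | Px ∷ Py ∷ _ | (x≢y ∷ _) ∷ _ = contradiction (P-unique Px Py) x≢y

    three-in-filter : ∀ {xs} → Unique xs → 3 ≤ length (filter P? xs) →
                      ∃ λ x → ∃ λ y → ∃ λ z → (x ≢ y × x ≢ z × y ≢ z) × P x × P y × P z
    three-in-filter {xs} xs! l with filter P? xs | All.all-filter P? xs | Unique.filter⁺ P? xs!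
    three-in-filter {xs} xs! ()             | []       | _ | _
    three-in-filter {xs} xs! (s≤s ())       | _ ∷ []   | _ | _
    three-in-filter {xs} xs! (s≤s (s≤s ())) | _ ∷ _ ∷ [] | _ | _
    ... | x ∷ y ∷ z ∷ _ | Px ∷ Py ∷ Pz ∷ _ | (x≢y ∷ x≢z ∷ _) ∷ (y≢z ∷ _) ∷ _ =
      x , y , z , (x≢y , x≢z , y≢z) , Px , Py , Pz

    one-in-filter : ∀ {xs} → 1 ≤ length (filter P? xs) → ∃ P
    one-in-filter {xs} l with filter P? xs | All.all-filter P? xs
    one-in-filter {xs} () | [] | _
    ... | x ∷ _ | Px ∷ _ = x , Px

  module _ (h : A → ℕ) where

    ∈⇒≤sum : ∀ {xs x} → x ∈ₗ xs → h x ≤ sum (map h xs)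
    ∈⇒≤sum (here refl)              = m≤m+n _ _
    ∈⇒≤sum {x ∷ xs} (there y∈) = ≤-trans (∈⇒≤sum y∈) (m≤n+m _ (h x))

    ∈-∈⇒≤sum : ∀ {xs x y} → x ≢ y → x ∈ₗ xs → y ∈ₗ xs → h x + h y ≤ sum (map h xs)
    ∈-∈⇒≤sum x≢y (here refl) (here refl) = contradiction refl x≢y
    ∈-∈⇒≤sum x≢y (here refl) (there y∈)  = +-monoʳ-≤ _ (∈⇒≤sum y∈)
    ∈-∈⇒≤sum {x = x} {y} x≢y (there x∈) (here refl) rewrite +-comm (h x) (h y) = +-monoʳ-≤ _ (∈⇒≤sum x∈)
    ∈-∈⇒≤sum {z ∷ _} x≢y (there x∈) (there y∈)  = ≤-trans (∈-∈⇒≤sum x≢y x∈ y∈) (m≤n+m _ (h z))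

    #_ : ℕ → List A → ℕ
    (# k) xs = length (filter (λ x → h x ≟ℕ k) xs)

    private
      2*suc : ∀ l → 2 * suc l ≡ 2 + 2 * l
      2*suc = solve-∀

    -- An entry falls short of 2 only when it is 1 (by one) or 0 (by two). When the sum is well
    -- below twice the length, this forces many entries equal to 1.
    2*length≤ : ∀ xs → 2 * length xs ≤ sum (map h xs) + ((# 1) xs + 2 * (# 0) xs)
    2*length≤ []       = z≤n
    2*length≤ (x ∷ xs) with h x
    ... | 0 = begin
      2 * suc (length xs)             ≡⟨ 2*suc (length xs) ⟩
      2 + 2 * length xs               ≤⟨ +-monoʳ-≤ 2 (2*length≤ xs) ⟩
      2 + (s + (o + 2 * z))           ≡⟨ eq s o z ⟩
      s + (o + 2 * suc z)             ∎
      where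
      open ≤-Reasoning
      s = sum (map h xs)
      o = (# 1) xs
      z = (# 0) xs
      eq : ∀ s o z → 2 + (s + (o + 2 * z)) ≡ s + (o + 2 * suc z)
      eq = solve-∀
    ... | 1 = begin
      2 * suc (length xs)             ≡⟨ 2*suc (length xs) ⟩
      2 + 2 * length xs               ≤⟨ +-monoʳ-≤ 2 (2*length≤ xs) ⟩
      2 + (s + (o + 2 * z))           ≡⟨ eq s o z ⟩
      1 + s + (suc o + 2 * z)         ∎
      where
      open ≤-Reasoning
      s = sum (map h xs)
      o = (# 1) xs
      z = (# 0) xs
      eq : ∀ s o z → 2 + (s + (o + 2 * z)) ≡ 1 + s + (suc o + 2 * z)
      eq = solve-∀
    ... | suc (suc k) = begin
      2 * suc (length xs)             ≡⟨ 2*suc (length xs) ⟩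
      2 + 2 * length xs               ≤⟨ +-monoʳ-≤ 2 (2*length≤ xs) ⟩
      2 + (s + t)                     ≤⟨ +-monoʳ-≤ 2 (+-monoˡ-≤ t (m≤n+m s k)) ⟩
      2 + k + s + t                   ∎
      where
      open ≤-Reasoning
      s = sum (map h xs)
      t = (# 1) xs + 2 * (# 0) xs

    -- Entrywise, `1 + (h x ∸ 1)` is `h x`, except at `h x = 0`, where truncation adds one.
    length+excess≤ : ∀ xs → length xs + sum (map (λ x → h x ∸ 1) xs) ≤ sum (map h xs) + (# 0) xs
    length+excess≤ []       = z≤n
    length+excess≤ (x ∷ xs) with h x
    ... | 0     = ≤-trans (s≤s (length+excess≤ xs)) (≤-reflexive (sym (+-suc _ _)))
    ... | suc k = s≤s (begin
      l + (k + e) ≡⟨ eq l k e ⟩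
      k + (l + e) ≤⟨ +-monoʳ-≤ k (length+excess≤ xs) ⟩
      k + (s + z) ≡⟨ eq′ k s z ⟩
      k + s + z   ∎)
      where
      open ≤-Reasoning
      l = length xs
      e = sum (map (λ x → h x ∸ 1) xs)
      s = sum (map h xs)
      z = (# 0) xs
      eq : ∀ l k e → l + (k + e) ≡ k + (l + e)
      eq = solve-∀
      eq′ : ∀ k s z → k + (s + z) ≡ k + s + z
      eq′ = solve-∀

-- Degrees of rows and columns as fibre sizes of a projection.

module Degree {A : Set} {n : ℕ} (f : A → Fin n) where

  fibre : List A → Fin n → List A
  fibre xs i = filter (λ x → f x ≟ i) xs

  degree : List A → Fin n → ℕ
  degree xs i = length (fibre xs i)

  ∈-fibre : ∀ {xs x i} → x ∈ₗ xs → f x ≡ i → x ∈ₗ fibre xs i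
  ∈-fibre = ∈-filter⁺ (λ x → f x ≟ _)

  degree0⇒∉ : ∀ {xs i x} → degree xs i ≡ 0 → x ∈ₗ xs → f x ≢ i
  degree0⇒∉ {xs} {i} d≡0 x∈ fx≡i with fibre xs i | ∈-fibre x∈ fx≡i
  degree0⇒∉ () _ _ | _ ∷ _ | _

  degree1⇒∃! : ∀ {xs i} → degree xs i ≡ 1 →
               ∃ λ x → (x ∈ₗ xs × f x ≡ i) × (∀ {y} → y ∈ₗ xs → f y ≡ i → y ≡ x)
  degree1⇒∃! {xs} {i} d≡1 with fibre xs i in eq
  degree1⇒∃! {xs} {i} refl | x ∷ [] = x , ∈-filter⁻ (λ y → f y ≟ i) x∈fibre , λ y∈ fy≡i →
    length≤1⇒≡ (≤-reflexive (cong length eq)) (∈-fibre y∈ fy≡i) x∈fibre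
    where
    x∈fibre : x ∈ₗ fibre xs i
    x∈fibre = subst (x ∈ₗ_) (sym eq) (here refl)

  -- Only the index `f x` gains a codeword, and it occurs at most once in `is`.
  sum-degree-∷ : ∀ x xs {is} → Unique is →
                 sum (map (degree (x ∷ xs)) is) ≤ suc (sum (map (degree xs) is))
  sum-degree-∷ x xs []                        = z≤n
  sum-degree-∷ x xs {i ∷ is} (i∉is ∷ is!) with f x ≟ i
  ... | yes refl = s≤s (+-monoʳ-≤ _ (≤-reflexive (cong sum (map-cong-local
                     (All-map (λ fx≢j → cong length (filter-reject (λ y → f y ≟ _) fx≢j)) i∉is)))))
  ... | no  _    = ≤-trans (+-monoʳ-≤ (degree xs i) (sum-degree-∷ x xs is!)) (≤-reflexive (+-suc _ _))

  sum-degree≤length : ∀ xs {is} → Unique is → sum (map (degree xs) is) ≤ length xs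
  sum-degree≤length [] {is} _ = ≤-reflexive (sum-zeros is)
    where
    sum-zeros : ∀ is → sum (map (degree []) is) ≡ 0
    sum-zeros []       = refl
    sum-zeros (_ ∷ is) = sum-zeros is
  sum-degree≤length (x ∷ xs) is! = ≤-trans (sum-degree-∷ x xs is!) (s≤s (sum-degree≤length xs is!))

-- Vertices with equal traces, separation and domination.

Confined : ∀ {n m} → Pred (Fin n × Fin m) 0ℓ → (r r′ : Fin n) (c c′ : Fin m) → Set
Confined C r r′ c c′ = ∀ {p q} → C (p , q) →
  (p ≡ r ⊎ p ≡ r′ → q ≡ c ⊎ q ≡ c′) × (q ≡ c ⊎ q ≡ c′ → p ≡ r ⊎ p ≡ r′)

module Twins {n m : ℕ} (C : Pred (Fin n × Fin m) 0ℓ) where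

  private
    G = K n ⊗ K m

    variable
      r r′ p : Fin n
      c c′ q : Fin m

  trace : V G → Pred (V G) 0ℓ
  trace x = N[_] G x ∩ C

  confined-swap : Confined C r r′ c c′ → Confined C r′ r c′ c
  confined-swap conf v∈ = swap ∘ proj₁ (conf v∈) ∘ swap , swap ∘ proj₂ (conf v∈) ∘ swap

  -- A codeword adjacent to `(r , c)` avoids row `r` and column `c`. By confinement it then cannot
  -- lie in exactly one of row `r′` and column `c′`.
  confined⇒⊆ : r ≢ r′ → c ≢ c′ → Confined C r r′ c c′ → trace (r , c) ⊆ trace (r′ , c′)
  confined⇒⊆ r≢r′ c≢c′ conf (inj₁ refl , v∈) = inj₂ (≢-sym r≢r′ , ≢-sym c≢c′) , v∈
  confined⇒⊆ {r′ = r′} {c′ = c′} r≢r′ c≢c′ conf {p , q} (inj₂ (r≢p , c≢q) , v∈)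
    with p ≟ r′ | q ≟ c′
  ... | yes refl | yes refl  = inj₁ refl , v∈
  ... | no p≢r′  | no q≢c′   = inj₂ (≢-sym p≢r′ , ≢-sym q≢c′) , v∈
  ... | yes p≡r′ | no q≢c′   =
    ⊥-elim ([ c≢q ∘ sym , q≢c′ ]′ (proj₁ (conf v∈) (inj₂ p≡r′)))
  ... | no p≢r′  | yes q≡c′  =
    ⊥-elim ([ r≢p ∘ sym , p≢r′ ]′ (proj₂ (conf v∈) (inj₂ q≡c′)))

  confined⇒≐ : r ≢ r′ → c ≢ c′ → Confined C r r′ c c′ → trace (r , c) ≐ trace (r′ , c′)
  confined⇒≐ r≢r′ c≢c′ conf =
    confined⇒⊆ r≢r′ c≢c′ conf , confined⇒⊆ (≢-sym r≢r′) (≢-sym c≢c′) (confined-swap conf)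

  private
    -- A codeword of row `r′` outside column `c` is adjacent to `(r , c)`, so it lies in the trace
    -- of `(r′ , c′)`. Sharing the row of that vertex, it can only be the vertex itself.
    ⊆⇒row : r ≢ r′ → trace (r , c) ⊆ trace (r′ , c′) → C (r′ , q) → q ≡ c ⊎ q ≡ c′
    ⊆⇒row {c = c} {q = q} r≢r′ sub v∈ with q ≟ c
    ... | yes q≡c = inj₁ q≡c
    ... | no  q≢c with sub (inj₂ (r≢r′ , ≢-sym q≢c) , v∈)
    ... | inj₁ refl , _         = inj₂ refl
    ... | inj₂ (r′≢r′ , _) , _ = contradiction refl r′≢r′

    ⊆⇒column : c ≢ c′ → trace (r , c) ⊆ trace (r′ , c′) → C (p , c′) → p ≡ r ⊎ p ≡ r′
    ⊆⇒column {r = r} {p = p} c≢c′ sub v∈ with p ≟ r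
    ... | yes p≡r = inj₁ p≡r
    ... | no  p≢r with sub (inj₂ (≢-sym p≢r , c≢c′) , v∈)
    ... | inj₁ refl , _         = inj₂ refl
    ... | inj₂ (_ , c′≢c′) , _ = contradiction refl c′≢c′

  ≐⇒confined : r ≢ r′ → c ≢ c′ → trace (r , c) ≐ trace (r′ , c′) → Confined C r r′ c c′
  ≐⇒confined r≢r′ c≢c′ (sub , sup) v∈ =
    (λ { (inj₁ refl) → swap (⊆⇒row (≢-sym r≢r′) sup v∈)
       ; (inj₂ refl) → ⊆⇒row r≢r′ sub v∈ }) ,
    (λ { (inj₁ refl) → swap (⊆⇒column (≢-sym c≢c′) sup v∈)
       ; (inj₂ refl) → ⊆⇒column c≢c′ sub v∈ })

  -- Only codewords in columns `c` and `c′` could tell apart two vertices of a common row.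
  empty-columns⇒⊆ : (∀ {p} → ¬ C (p , c)) → (∀ {p} → ¬ C (p , c′)) →
                    trace (r , c) ⊆ trace (r , c′)
  empty-columns⇒⊆ c-empty c′-empty (inj₁ refl , v∈)        = contradiction v∈ c-empty
  empty-columns⇒⊆ c-empty c′-empty (inj₂ (r≢p , c≢q) , v∈) =
    inj₂ (r≢p , λ { refl → c′-empty v∈ }) , v∈

  empty-rows⇒⊆ : (∀ {q} → ¬ C (r , q)) → (∀ {q} → ¬ C (r′ , q)) →
                 trace (r , c) ⊆ trace (r′ , c)
  empty-rows⇒⊆ r-empty r′-empty (inj₁ refl , v∈)        = contradiction v∈ r-empty
  empty-rows⇒⊆ r-empty r′-empty (inj₂ (r≢p , c≢q) , v∈) =
    inj₂ ((λ { refl → r′-empty v∈ }) , c≢q) , v∈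

  -- A codeword of column `c` outside row `r` is adjacent to `(r , c′)` but not to `(r , c)`; one in
  -- row `r` is `(r , c)` itself, which `(r , c′)` does not see.
  ≐⇒empty-column : c ≢ c′ → trace (r , c) ≐ trace (r , c′) → ¬ C (p , c)
  ≐⇒empty-column {r = r} {p = p} c≢c′ (sub , sup) v∈ with r ≟ p
  ... | no r≢p with sup (inj₂ (r≢p , ≢-sym c≢c′) , v∈)
  ...   | inj₁ refl , _        = r≢p refl
  ...   | inj₂ (_ , c≢c) , _   = c≢c refl
  ≐⇒empty-column c≢c′ (sub , sup) v∈ | yes refl with sub (inj₁ refl , v∈)
  ...   | inj₁ refl , _        = c≢c′ refl
  ...   | inj₂ (r≢r , _) , _   = r≢r refl

  ≐⇒empty-row : r ≢ r′ → trace (r , c) ≐ trace (r′ , c) → ¬ C (r , q)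
  ≐⇒empty-row {c = c} {q = q} r≢r′ (sub , sup) v∈ with c ≟ q
  ... | no c≢q with sup (inj₂ (≢-sym r≢r′ , c≢q) , v∈)
  ...   | inj₁ refl , _        = c≢q refl
  ...   | inj₂ (r≢r , _) , _   = r≢r refl
  ≐⇒empty-row r≢r′ (sub , sup) v∈ | yes refl with sub (inj₁ refl , v∈)
  ...   | inj₁ refl , _        = r≢r′ refl
  ...   | inj₂ (_ , c≢c) , _   = c≢c refl

  -- Rows and columns are treated asymmetrically because the code built below meets every row but
  -- leaves one column empty.
  separating : (∀ {r} → ∃ λ q → C (r , q)) →
               (∀ {c c′} → c ≢ c′ → ∃ λ p → C (p , c) ⊎ C (p , c′)) →
               (∀ {r r′ c c′} → r ≢ r′ → ¬ Confined C r r′ c c′) →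
               IsSeparating G C
  separating row columns ¬confined (r , c) (r′ , c′) x≢y tw with r ≟ r′ | c ≟ c′
  ... | yes refl | yes refl  = x≢y refl
  ... | no r≢r′  | no c≢c′   = ¬confined r≢r′ (≐⇒confined r≢r′ c≢c′ tw)
  ... | no r≢r′  | yes refl  = ≐⇒empty-row r≢r′ tw (proj₂ row)
  ... | yes refl | no c≢c′ with columns c≢c′
  ...   | p , inj₁ v∈ = ≐⇒empty-column c≢c′ tw v∈
  ...   | p , inj₂ v∈ = ≐⇒empty-column (≢-sym c≢c′) (proj₂ tw , proj₁ tw) v∈

  -- If `(r , c)` neither equals nor sees the first codeword, it shares exactly one line with it.
  -- Its other line can meet at most one of the remaining two codewords, so the other one dominates
  -- it.
  dominating : ∀ {p₁ p₂ p₃ q₁ q₂ q₃} →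
               p₁ ≢ p₂ × p₁ ≢ p₃ × p₂ ≢ p₃ → q₁ ≢ q₂ × q₁ ≢ q₃ × q₂ ≢ q₃ →
               C (p₁ , q₁) → C (p₂ , q₂) → C (p₃ , q₃) → IsDominating G C
  dominating {p₁} {p₂} {p₃} {q₁} {q₂} {q₃} (p₁₂ , p₁₃ , p₂₃) (q₁₂ , q₁₃ , q₂₃) v₁∈ v₂∈ v₃∈ (r , c)
    with r ≟ p₁ | c ≟ q₁
  ... | no r≢p₁  | no c≢q₁   = (p₁ , q₁) , inj₂ (r≢p₁ , c≢q₁) , v₁∈
  ... | yes refl | yes refl  = (p₁ , q₁) , inj₁ refl , v₁∈
  ... | yes refl | no _ with c ≟ q₂
  ...   | no c≢q₂  = (p₂ , q₂) , inj₂ (p₁₂ , c≢q₂) , v₂∈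
  ...   | yes refl = (p₃ , q₃) , inj₂ (p₁₃ , q₂₃) , v₃∈
  dominating {p₁} {p₂} {p₃} {q₁} {q₂} {q₃} (p₁₂ , p₁₃ , p₂₃) (q₁₂ , q₁₃ , q₂₃) v₁∈ v₂∈ v₃∈ (r , c)
    | no _ | yes refl with r ≟ p₂
  ...   | no r≢p₂  = (p₂ , q₂) , inj₂ (r≢p₂ , q₁₂) , v₂∈
  ...   | yes refl = (p₃ , q₃) , inj₂ (p₂₃ , q₁₃) , v₃∈

-- Lower bound: no separating code is this small.

module LowerBound {n m : ℕ} (C : List (Fin (suc n) × Fin (suc m)))
  (sep : IsSeparating (K (suc n) ⊗ K (suc m)) (_∈ₗ C))
  (length≤rows : 5 + length C ≤ 2 * suc n) (length≤columns : length C ≤ suc m) where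

  open Twins (_∈ₗ C)

  module Row    = Degree {n = suc n} (proj₁ {A = Fin (suc n)} {B = λ _ → Fin (suc m)})
  module Column = Degree {n = suc m} (proj₂ {A = Fin (suc n)} {B = λ _ → Fin (suc m)})

  rows : List (Fin (suc n))
  rows = allFin (suc n)

  columns : List (Fin (suc m))
  columns = allFin (suc m)

  private variable
    r r′ : Fin (suc n)
    c c′ : Fin (suc m)

  ¬confined : r ≢ r′ → c ≢ c′ → ¬ Confined (_∈ₗ C) r r′ c c′
  ¬confined r≢r′ c≢c′ conf = sep _ _ (r≢r′ ∘ cong proj₁) (confined⇒≐ r≢r′ c≢c′ conf)

  empty-row-unique : Row.degree C r ≡ 0 → Row.degree C r′ ≡ 0 → r ≡ r′
  empty-row-unique {r} {r′} r-empty r′-empty with r ≟ r′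
  ... | yes r≡r′ = r≡r′
  -- Any common column serves; `zero` is available since there are `suc m` columns.
  ... | no  r≢r′ = ⊥-elim (sep (r , zero) (r′ , zero) (r≢r′ ∘ cong proj₁)
                     (empty-rows⇒⊆ ∉r ∉r′ , empty-rows⇒⊆ ∉r′ ∉r))
    where
    ∉r : ∀ {q} → ¬ ((r , q) ∈ₗ C)
    ∉r v∈ = Row.degree0⇒∉ r-empty v∈ refl
    ∉r′ : ∀ {q} → ¬ ((r′ , q) ∈ₗ C)
    ∉r′ v∈ = Row.degree0⇒∉ r′-empty v∈ refl

  empty-column-unique : Column.degree C c ≡ 0 → Column.degree C c′ ≡ 0 → c ≡ c′
  empty-column-unique {c} {c′} c-empty c′-empty with c ≟ c′
  ... | yes c≡c′ = c≡c′
  ... | no  c≢c′ = ⊥-elim (sep (zero , c) (zero , c′) (c≢c′ ∘ cong proj₂)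
                     (empty-columns⇒⊆ ∉c ∉c′ , empty-columns⇒⊆ ∉c′ ∉c))
    where
    ∉c : ∀ {p} → ¬ ((p , c) ∈ₗ C)
    ∉c v∈ = Column.degree0⇒∉ c-empty v∈ refl
    ∉c′ : ∀ {p} → ¬ ((p , c′) ∈ₗ C)
    ∉c′ v∈ = Column.degree0⇒∉ c′-empty v∈ refl

  #-single-rows : 3 ≤ (# Row.degree C) 1 rows
  -- The cancelled 2 is the deficit of the one row that may be empty, leaving 3 of the surplus 5.
  #-single-rows = +-cancelˡ-≤ (2 + length C) 3 o (begin
    2 + length C + 3     ≡⟨ eq₁ (length C) ⟩
    5 + length C         ≤⟨ length≤rows ⟩
    2 * suc n            ≡⟨ cong (2 *_) (length-tabulate {n = suc n} (λ i → i)) ⟨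
    2 * length rows      ≤⟨ 2*length≤ (Row.degree C) rows ⟩
    s + (o + 2 * z)      ≤⟨ +-mono-≤ (Row.sum-degree≤length C (Unique.allFin⁺ (suc n)))
                              (+-monoʳ-≤ o (*-monoʳ-≤ 2 z≤1)) ⟩
    length C + (o + 2)   ≡⟨ eq₂ (length C) o ⟩
    2 + length C + o     ∎)
    where
    open ≤-Reasoning
    s = sum (map (Row.degree C) rows)
    o = (# Row.degree C) 1 rows
    z = (# Row.degree C) 0 rows
    z≤1 : z ≤ 1
    z≤1 = length-filter≤1 (λ r → Row.degree C r ≟ℕ 0) empty-row-unique (Unique.allFin⁺ (suc n))
    eq₁ : ∀ l → 2 + l + 3 ≡ 5 + l
    eq₁ = solve-∀
    eq₂ : ∀ l o → l + (o + 2) ≡ 2 + l + o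
    eq₂ = solve-∀

  excess : Fin (suc m) → ℕ
  excess c = Column.degree C c ∸ 1

  #-empty-columns : ℕ
  #-empty-columns = (# Column.degree C) 0 columns

  #-empty-columns≤1 : #-empty-columns ≤ 1
  #-empty-columns≤1 = length-filter≤1 (λ c → Column.degree C c ≟ℕ 0) empty-column-unique (Unique.allFin⁺ (suc m))

  sum-excess≤ : sum (map excess columns) ≤ #-empty-columns
  sum-excess≤ = +-cancelˡ-≤ (suc m) _ _ (begin
    suc m + e                ≡⟨ cong (_+ e) (length-tabulate {n = suc m} (λ i → i)) ⟨
    length columns + e       ≤⟨ length+excess≤ (Column.degree C) columns ⟩
    s + #-empty-columns      ≤⟨ +-monoˡ-≤ #-empty-columns sum-degree≤ ⟩
    suc m + #-empty-columns  ∎)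
    where
    open ≤-Reasoning
    s = sum (map (Column.degree C) columns)
    e = sum (map excess columns)
    sum-degree≤ : s ≤ suc m
    sum-degree≤ = ≤-trans (Column.sum-degree≤length C (Unique.allFin⁺ (suc m))) length≤columns

  Heavy : Fin (suc m) → Set
  Heavy c = 2 ≤ Column.degree C c

  -- Two heavy columns would each contribute at least 1 to a total excess of at most 1.
  heavy-unique : Heavy c → Heavy c′ → c ≡ c′
  heavy-unique {c} {c′} c-heavy c′-heavy with c ≟ c′
  ... | yes c≡c′ = c≡c′
  ... | no  c≢c′ = contradiction (begin
    2                        ≤⟨ +-mono-≤ (∸-monoˡ-≤ 1 c-heavy) (∸-monoˡ-≤ 1 c′-heavy) ⟩
    excess c + excess c′     ≤⟨ ∈-∈⇒≤sum excess c≢c′ (∈-allFin c) (∈-allFin c′) ⟩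
    sum (map excess columns) ≤⟨ sum-excess≤ ⟩
    #-empty-columns          ≤⟨ #-empty-columns≤1 ⟩
    1                        ∎) 1+n≰n
    where open ≤-Reasoning

  excess≤#-empty-columns : excess c ≤ #-empty-columns
  excess≤#-empty-columns {c} = ≤-trans (∈⇒≤sum excess (∈-allFin c)) sum-excess≤

  degree≤2 : Column.degree C c ≤ 2
  degree≤2 {c} with Column.degree C c | ≤-trans (excess≤#-empty-columns {c}) #-empty-columns≤1
  ... | zero  | _ = z≤n
  ... | suc _ | d = s≤s d

  -- The total excess is at most the number of empty columns, so positive excess forces that number
  -- to be positive.
  heavy⇒empty-column : Heavy c → ∃ λ c₀ → Column.degree C c₀ ≡ 0
  heavy⇒empty-column {c} c-heavy =
    one-in-filter (λ c → Column.degree C c ≟ℕ 0) {columns}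
      (≤-trans (∸-monoˡ-≤ 1 c-heavy) (excess≤#-empty-columns {c}))

  record Single (r : Fin (suc n)) (c : Fin (suc m)) : Set where
    field
      codeword : (r , c) ∈ₗ C
      unique   : ∀ {q} → (r , q) ∈ₗ C → q ≡ c

  open Single

  single : Row.degree C r ≡ 1 → ∃ (Single r)
  single d≡1 with Row.degree1⇒∃! {C} d≡1
  ... | (_ , c) , (v∈ , refl) , unq = c , record
    { codeword = v∈
    ; unique   = λ w∈ → cong proj₂ (unq w∈ refl)
    }

  shared⇒heavy : r ≢ r′ → Single r c → Single r′ c → Heavy c
  shared⇒heavy {c = c} r≢r′ x y with 2 ≤? Column.degree C c
  ... | yes c-heavy = c-heavy
  ... | no  c-light = contradiction
    (cong proj₁ (length≤1⇒≡ (s≤s⁻¹ (≰⇒> c-light))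
      (Column.∈-fibre (codeword x) refl) (Column.∈-fibre (codeword y) refl))) r≢r′

  columns-differ : r ≢ r′ → Single r c → Single r′ c′ → c ≢ c′
  columns-differ {r} {r′} {c} r≢r′ x y refl with heavy⇒empty-column (shared⇒heavy r≢r′ x y)
  ... | c₀ , c₀-empty = ¬confined r≢r′ c≢c₀ conf
    where
    c≢c₀ : c ≢ c₀
    c≢c₀ c≡c₀ = Column.degree0⇒∉ c₀-empty (codeword x) c≡c₀

    conf : Confined (_∈ₗ C) r r′ c c₀
    conf v∈ =
      (λ { (inj₁ refl) → inj₁ (unique x v∈)
         ; (inj₂ refl) → inj₁ (unique y v∈) }) ,
      -- Column `c` holds at most two codewords, and the single codewords of `r` and `r′` already
      -- fill it.
      (λ { (inj₁ refl) → [ inj₁ ∘ cong proj₁ , inj₂ ∘ cong proj₁ ]′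
             (length≤2⇒≡⊎≡ degree≤2 (r≢r′ ∘ cong proj₁)
               (Column.∈-fibre (codeword x) refl) (Column.∈-fibre (codeword y) refl)
               (Column.∈-fibre v∈ refl))
         ; (inj₂ q≡c₀) → contradiction q≡c₀ (Column.degree0⇒∉ c₀-empty v∈) })

  heavy-column : r ≢ r′ → Single r c → Single r′ c′ → Heavy c ⊎ Heavy c′
  heavy-column {r} {r′} {c} {c′} r≢r′ x y with 2 ≤? Column.degree C c | 2 ≤? Column.degree C c′
  ... | yes c-heavy | _            = inj₁ c-heavy
  ... | no _        | yes c′-heavy = inj₂ c′-heavy
  ... | no c-light  | no c′-light  = ⊥-elim (¬confined r≢r′ (columns-differ r≢r′ x y) conf)
    where
    conf : Confined (_∈ₗ C) r r′ c c′
    conf v∈ =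
      (λ { (inj₁ refl) → inj₁ (unique x v∈)
         ; (inj₂ refl) → inj₂ (unique y v∈) }) ,
      (λ { (inj₁ refl) → inj₁ (cong proj₁ (length≤1⇒≡ (s≤s⁻¹ (≰⇒> c-light))
             (Column.∈-fibre v∈ refl) (Column.∈-fibre (codeword x) refl)))
         ; (inj₂ refl) → inj₂ (cong proj₁ (length≤1⇒≡ (s≤s⁻¹ (≰⇒> c′-light))
             (Column.∈-fibre v∈ refl) (Column.∈-fibre (codeword y) refl))) })

  no-small-code : ⊥
  no-small-code with three-in-filter (λ r → Row.degree C r ≟ℕ 1) (Unique.allFin⁺ (suc n)) #-single-rows
  ... | r , s , t , (r≢s , r≢t , s≢t) , r-single , s-single , t-single
    with single r-single | single s-single | single t-single
  ... | a , x | b , y | c , z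
    with heavy-column r≢s x y | heavy-column r≢t x z | heavy-column s≢t y z
  -- Whichever row the first pair supplies with a heavy column, the pair avoiding that row supplies
  -- another. Uniqueness of the heavy column then puts two single codewords in one column.
  ... | inj₁ a-heavy | _            | inj₁ b-heavy = columns-differ r≢s x y (heavy-unique a-heavy b-heavy)
  ... | inj₁ a-heavy | _            | inj₂ c-heavy = columns-differ r≢t x z (heavy-unique a-heavy c-heavy)
  ... | inj₂ b-heavy | inj₁ a-heavy | _            = columns-differ r≢s x y (heavy-unique a-heavy b-heavy)
  ... | inj₂ b-heavy | inj₂ c-heavy | _            = columns-differ s≢t y z (heavy-unique b-heavy c-heavy)

-- Upper bound: an explicit code.

-- The edges of the three-row star in column 1, the isolated edge in column 2,
-- and column 3 + j in row 4 + ⌊ j / 2 ⌋; column 0 stays empty.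
module Construction (k : ℕ) where

  Vertex : Set
  Vertex = Fin (4 + k) × Fin (3 + k * 2)

  edge : Fin (k * 2) → Vertex
  edge j = 4 ↑ʳ quotient 2 j , 3 ↑ʳ j

  r₀ r₁ r₂ r₃ : Fin (4 + k)
  r₀ = zero
  r₁ = suc zero
  r₂ = suc (suc zero)
  r₃ = suc (suc (suc zero))

  c₁ c₂ : Fin (3 + k * 2)
  c₁ = suc zero
  c₂ = suc (suc zero)

  edges : List Vertex
  edges = map edge (allFin (k * 2))

  code : List Vertex
  code = (r₀ , c₁) ∷ (r₁ , c₁) ∷ (r₂ , c₁) ∷ (r₃ , c₂) ∷ edges

  pattern 1st = here refl
  pattern 2nd = there (here refl)
  pattern 3rd = there (there (here refl))
  pattern 4th = there (there (there (here refl)))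
  pattern edge∈ p = there (there (there (there p)))

  ∉edges : ∀ {v} → (∀ j → v ≢ edge j) → All (v ≢_) edges
  ∉edges v≢ = All.map⁺ (All.tabulate⁺ v≢)

  code-unique : Unique code
  code-unique =
    ((λ ()) ∷ (λ ()) ∷ (λ ()) ∷ ∉edges (λ _ ())) ∷
    ((λ ()) ∷ (λ ()) ∷ ∉edges (λ _ ())) ∷
    ((λ ()) ∷ ∉edges (λ _ ())) ∷
    ∉edges (λ _ ()) ∷
    Unique.map⁺ (↑ʳ-injective 3 _ _ ∘ cong proj₂) (Unique.allFin⁺ (k * 2))

  length-code : length code ≡ 4 + k * 2
  length-code = cong (4 +_) (trans (length-map edge (allFin (k * 2))) (length-tabulate {n = k * 2} (λ i → i)))

  edge∈code : ∀ j → edge j ∈ₗ code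
  edge∈code j = edge∈ (∈-map⁺ edge (∈-allFin j))

  -- The two columns of the star in row `4 ↑ʳ i`: `quotient 2` sends `combine i b` back to `i`.
  leaf : Fin k → Fin 2 → Fin (3 + k * 2)
  leaf i b = 3 ↑ʳ combine i b

  leaf∈code : ∀ i b → (4 ↑ʳ i , leaf i b) ∈ₗ code
  leaf∈code i b = subst (λ i′ → (4 ↑ʳ i′ , leaf i b) ∈ₗ code)
                    (cong proj₁ (remQuot-combine i b)) (edge∈code (combine i b))

  edge-row-unique : ∀ {p j} → (p , 3 ↑ʳ j) ∈ₗ code → p ≡ 4 ↑ʳ quotient 2 j
  edge-row-unique (edge∈ v∈) with ∈-map⁻ edge v∈
  ... | _ , _ , refl = refl

  leaf-row-unique : ∀ {p i b} → (p , leaf i b) ∈ₗ code → p ≡ 4 ↑ʳ i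
  leaf-row-unique {i = i} {b} v∈ =
    trans (edge-row-unique v∈) (cong (4 ↑ʳ_) (cong proj₁ (remQuot-combine i b)))

  row : ∀ {r} → ∃ λ q → (r , q) ∈ₗ code
  row {zero}                      = _ , 1st
  row {suc zero}                  = _ , 2nd
  row {suc (suc zero)}            = _ , 3rd
  row {suc (suc (suc zero))}      = _ , 4th
  row {suc (suc (suc (suc i)))}   = _ , leaf∈code i zero

  column : ∀ c → ∃ λ p → (p , suc c) ∈ₗ code
  column zero          = _ , 1st
  column (suc zero)    = _ , 4th
  column (suc (suc j)) = _ , edge∈code j

  columns : ∀ {c c′} → c ≢ c′ → ∃ λ p → (p , c) ∈ₗ code ⊎ (p , c′) ∈ₗ code
  columns {suc c} {_}      _    = _ , inj₁ (proj₂ (column c))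
  columns {zero}  {suc c′} _    = _ , inj₂ (proj₂ (column c′))
  columns {zero}  {zero}   c≢c′ = contradiction refl c≢c′

  module _ {r r′ c c′} (conf : Confined (_∈ₗ code) r r′ c c′) where

    -- All three rows of the star would have to be among `r` and `r′`.
    ¬confined-star : c₁ ≡ c ⊎ c₁ ≡ c′ → ⊥
    ¬confined-star c₁∈ with proj₂ (conf 1st) c₁∈ | proj₂ (conf 2nd) c₁∈ | proj₂ (conf 3rd) c₁∈
    ... | inj₁ refl | inj₁ ()   | _
    ... | inj₁ refl | inj₂ refl | inj₁ ()
    ... | inj₁ refl | inj₂ refl | inj₂ ()
    ... | inj₂ refl | inj₂ ()   | _
    ... | inj₂ refl | inj₁ refl | inj₁ ()
    ... | inj₂ refl | inj₁ refl | inj₂ ()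

    -- The two leaves of such a row occupy both c and c′, leaving no column for r′.
    ¬confined-pair : ∀ {i} → r ≡ 4 ↑ʳ i → r ≢ r′ → ⊥
    ¬confined-pair {i} refl r≢r′ = r≢r′ (sym (leaf-row-unique (subst (λ q → (r′ , q) ∈ₗ code)
        (proj₂ (covered (proj₁ (conf (proj₂ row)) (inj₂ refl)))) (proj₂ row))))
      where
      leaves-differ : leaf i zero ≢ leaf i (suc zero)
      leaves-differ eq with combine-injectiveʳ i zero i (suc zero) (↑ʳ-injective 3 _ _ eq)
      ... | ()

      covered : ∀ {q} → q ≡ c ⊎ q ≡ c′ → ∃ λ b → q ≡ leaf i b
      covered q∈ with proj₁ (conf (leaf∈code i zero)) (inj₁ refl)
                    | proj₁ (conf (leaf∈code i (suc zero))) (inj₁ refl)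
      ... | inj₁ c≡l₀  | inj₁ c≡l₁  = contradiction (trans c≡l₀ (sym c≡l₁)) leaves-differ
      ... | inj₂ c′≡l₀ | inj₂ c′≡l₁ = contradiction (trans c′≡l₀ (sym c′≡l₁)) leaves-differ
      covered (inj₁ refl) | inj₁ l₀≡c  | inj₂ _     = zero , sym l₀≡c
      covered (inj₁ refl) | inj₂ _     | inj₁ l₁≡c  = suc zero , sym l₁≡c
      covered (inj₂ refl) | inj₁ _     | inj₂ l₁≡c′ = suc zero , sym l₁≡c′
      covered (inj₂ refl) | inj₂ l₀≡c′ | inj₁ _     = zero , sym l₀≡c′

  -- A row of the three-row star forces `c₁` to be one of the two columns, and a row with two leaves
  -- is excluded by `¬confined-pair`. Only `r₃` escapes both, and then `r′`, being different from
  -- it, does not.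
  ¬confined : ∀ {r r′ c c′} → r ≢ r′ → ¬ Confined (_∈ₗ code) r r′ c c′
  ¬confined {zero} r≢r′ conf = ¬confined-star conf (proj₁ (conf 1st) (inj₁ refl))
  ¬confined {suc zero} r≢r′ conf = ¬confined-star conf (proj₁ (conf 2nd) (inj₁ refl))
  ¬confined {suc (suc zero)} r≢r′ conf = ¬confined-star conf (proj₁ (conf 3rd) (inj₁ refl))
  ¬confined {suc (suc (suc (suc i)))} r≢r′ conf = ¬confined-pair conf refl r≢r′
  ¬confined {suc (suc (suc zero))} {zero} r≢r′ conf =
    ¬confined-star conf (proj₁ (conf 1st) (inj₂ refl))
  ¬confined {suc (suc (suc zero))} {suc zero} r≢r′ conf =
    ¬confined-star conf (proj₁ (conf 2nd) (inj₂ refl))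
  ¬confined {suc (suc (suc zero))} {suc (suc zero)} r≢r′ conf =
    ¬confined-star conf (proj₁ (conf 3rd) (inj₂ refl))
  ¬confined {suc (suc (suc zero))} {suc (suc (suc zero))} r≢r′ conf =
    contradiction refl r≢r′
  ¬confined {suc (suc (suc zero))} {suc (suc (suc (suc i)))} r≢r′ conf =
    ¬confined-pair (Twins.confined-swap (_∈ₗ code) conf) refl (≢-sym r≢r′)

-- Both bounds in terms of n = 5 + k.

hasIDCode : ∀ k → HasIDCodeOfSize (K (5 + k) ⊗ K (5 + k * 2)) (6 + k * 2)
hasIDCode k = code , code-unique , length-code ,
  dominating ((λ ()) , (λ ()) , (λ ())) ((λ ()) , (λ ()) , (λ ()))
    -- One codeword from each kind of component; the third exists because the construction is taken
    -- at `suc k`.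
    1st 4th (edge∈code zero) ,
  separating row columns ¬confined
  where
  open Construction (suc k)
  open Twins (_∈ₗ code)

IDCode-size≥ : ∀ k j → HasIDCodeOfSize (K (5 + k) ⊗ K (5 + k * 2)) j → 6 + k * 2 ≤ j
-- A smaller code has at most `5 + k * 2` elements, which is the number of columns and also five
-- less than twice the number of rows.
IDCode-size≥ k _ (C , _ , refl , _ , sep) = ≮⇒≥ λ { (s≤s |C|≤) →
  LowerBound.no-small-code C sep (≤-trans (+-monoʳ-≤ 5 |C|≤) (≤-reflexive (eq k))) |C|≤ }
  where
  eq : ∀ k → 5 + (5 + k * 2) ≡ 2 * (5 + k)
  eq = solve-∀

theorem4 : (n : ℕ) → 6 ≤ n → γᴵᴰ[ K n ⊗ K (2 * n ∸ 5) ]≡ (2 * n ∸ 4)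
theorem4 n 6≤n with m≤n⇒∃[o]m+o≡n 6≤n
-- Here n is `5 + k` with k = `suc o`. Writing 2n as `10 + k * 2` lets both truncated subtractions
-- compute.
... | o , refl = subst (λ 2n → γᴵᴰ[ K n ⊗ K (2n ∸ 5) ]≡ (2n ∸ 4)) (eq (suc o))
                   (hasIDCode (suc o) , IDCode-size≥ (suc o))
  where
  eq : ∀ k → 10 + k * 2 ≡ 2 * (5 + k)
  eq = solve-∀
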